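{- Let $G$ be a group, $k\ge1$ and $s\ge0$ integers such that for every $i<k$ there is a set $A_i\subseteq G$ with $|A_i|\le s$ such that $Z(G/Z_i(G))=C_{G/Z_i(G)}(A_i)$ (where $A_i$ is read via its image in $G/Z_i(G)$). Let $c\in G$. If the set $\{(x_0,\dots,x_k)\in G^{k+1}:[x_0,x_1,\dots,x_k]=c\}$ is $2(s+1)^k$-large in $G^{k+1}$, then $c=1$ and $G$ is nilpotent of class at most $k$.
   Context: $[a,b]=a^{ -1}b^{ -1}ab$ and commutators are left-normed: $[x_0,x_1,\dots,x_{j+1}]=[[x_0,\dots,x_j],x_{j+1}]$. $Z_i(G)$ denotes the $i$-th term of the upper central series ($Z_0(G)=1$, $Z_{i+1}(G)/Z_i(G)=Z(G/Z_i(G))$). A subset $X$ of a group $K$ is $m$-large in $K$ if the intersection of any $m$ left translates $a_1X\cap\dots\cap a_mX$ ($a_i\in K$) is non-empty. -}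

module Defs where

open import Algebra.Bundles using (Group)
import Algebra.Construct.Pointwise as Pointwise
import Algebra.Properties.Group as GroupProperties
open import Data.Fin.Base using (Fin; zero; inject₁; fromℕ)
open import Data.List.Base using (List)
import Data.List.Membership.Setoid as Membership
open import Data.Nat.Base using (ℕ; zero; suc)
open import Data.Product.Base using (∃-syntax; _×_; _,_)
open import Function.Base using (_∘_)
open import Level using (Level; _⊔_; Lift; lift)
open import Relation.Binary.Core using (_⇒_)
open import Relation.Unary using (Pred; _∈_; Universal)
import Relation.Binary.Reasoning.Setoid as SetoidReasoning

private
  variable
    c ℓ p : Level

record NormalSubgroup (G : Group c ℓ) (p : Level) : Set (c ⊔ ℓ ⊔ Level.suc p) where
  open Group G
  field
    Member    : Pred Carrier p
    resp      : ∀ {x y} → x ≈ y → x ∈ Member → y ∈ Member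
    ε-closed  : ε ∈ Member
    ∙-closed  : ∀ {x y} → x ∈ Member → y ∈ Member → (x ∙ y) ∈ Member
    ⁻¹-closed : ∀ {x} → x ∈ Member → (x ⁻¹) ∈ Member
    normal    : ∀ g {x} → x ∈ Member → (g ⁻¹ ∙ x ∙ g) ∈ Member

open NormalSubgroup public using (Member)

-- A quotient keeps the carrier and coarsens the equality: x and y are
-- identified when x ⁻¹ ∙ y ∈ N.  So the projection G → G / N is the identity
-- on carriers.

module _ (G : Group c ℓ) (N : NormalSubgroup G p) where
  open Group G
  open GroupProperties G
  open NormalSubgroup N hiding (Member)
  open SetoidReasoning setoid

  private
    _~_ : Carrier → Carrier → Set p
    x ~ y = (x ⁻¹ ∙ y) ∈ Member N

    ≈⇒~ : _≈_ ⇒ _~_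
    ≈⇒~ {x} {y} x≈y = resp (trans (sym (inverseˡ x)) (∙-congˡ x≈y)) ε-closed

    ~-sym : ∀ {x y} → x ~ y → y ~ x
    ~-sym {x} {y} x~y =
      resp (trans (⁻¹-anti-homo-∙ (x ⁻¹) y) (∙-congˡ (⁻¹-involutive x)))
           (⁻¹-closed x~y)

    ~-trans : ∀ {x y z} → x ~ y → y ~ z → x ~ z
    ~-trans {x} {y} {z} x~y y~z = resp eq (∙-closed x~y y~z)
      where
      eq : (x ⁻¹ ∙ y) ∙ (y ⁻¹ ∙ z) ≈ x ⁻¹ ∙ z
      eq = begin
        (x ⁻¹ ∙ y) ∙ (y ⁻¹ ∙ z)  ≈⟨ assoc _ _ _ ⟩
        x ⁻¹ ∙ (y ∙ (y ⁻¹ ∙ z))  ≈⟨ ∙-congˡ (\\-leftDividesˡ y z) ⟩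
        x ⁻¹ ∙ z                 ∎

    ~-∙-cong : ∀ {x y u v} → x ~ y → u ~ v → (x ∙ u) ~ (y ∙ v)
    ~-∙-cong {x} {y} {u} {v} x~y u~v = resp eq (∙-closed (normal u x~y) u~v)
      where
      eq : (u ⁻¹ ∙ (x ⁻¹ ∙ y) ∙ u) ∙ (u ⁻¹ ∙ v) ≈ (x ∙ u) ⁻¹ ∙ (y ∙ v)
      eq = begin
        (u ⁻¹ ∙ (x ⁻¹ ∙ y) ∙ u) ∙ (u ⁻¹ ∙ v)  ≈⟨ assoc _ _ _ ⟩
        u ⁻¹ ∙ (x ⁻¹ ∙ y) ∙ (u ∙ (u ⁻¹ ∙ v))  ≈⟨ ∙-congˡ (\\-leftDividesˡ u v) ⟩
        u ⁻¹ ∙ (x ⁻¹ ∙ y) ∙ v                 ≈⟨ ∙-congʳ (assoc _ _ _) ⟨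
        u ⁻¹ ∙ x ⁻¹ ∙ y ∙ v                   ≈⟨ assoc _ _ _ ⟩
        u ⁻¹ ∙ x ⁻¹ ∙ (y ∙ v)                 ≈⟨ ∙-congʳ (⁻¹-anti-homo-∙ x u) ⟨
        (x ∙ u) ⁻¹ ∙ (y ∙ v)                  ∎

    ~-⁻¹-cong : ∀ {x y} → x ~ y → (x ⁻¹) ~ (y ⁻¹)
    ~-⁻¹-cong {x} {y} x~y = resp eq (normal (y ⁻¹) (~-sym x~y))
      where
      eq : y ⁻¹ ⁻¹ ∙ (y ⁻¹ ∙ x) ∙ y ⁻¹ ≈ x ⁻¹ ⁻¹ ∙ y ⁻¹
      eq = ∙-congʳ (trans (\\-leftDividesʳ (y ⁻¹) x) (sym (⁻¹-involutive x)))

  infixl 6 _/_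

  _/_ : Group c p
  _/_ = record
    { Carrier = Carrier
    ; _≈_     = _~_
    ; _∙_     = _∙_
    ; ε       = ε
    ; _⁻¹     = _⁻¹
    ; isGroup = record
      { isMonoid = record
        { isSemigroup = record
          { isMagma = record
            { isEquivalence = record
              { refl = ≈⇒~ refl ; sym = ~-sym ; trans = ~-trans }
            ; ∙-cong = ~-∙-cong
            }
          ; assoc = λ x y z → ≈⇒~ (assoc x y z)
          }
        ; identity = (λ x → ≈⇒~ (identityˡ x)) , (λ x → ≈⇒~ (identityʳ x))
        }
      ; inverse = (λ x → ≈⇒~ (inverseˡ x)) , (λ x → ≈⇒~ (inverseʳ x))
      ; ⁻¹-cong = ~-⁻¹-cong
      }
    }

  preimage : ∀ {q} → NormalSubgroup _/_ q → NormalSubgroup G q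
  preimage M = record
    { Member    = Member M
    ; resp      = λ x≈y → M.resp (≈⇒~ x≈y)
    ; ε-closed  = M.ε-closed
    ; ∙-closed  = M.∙-closed
    ; ⁻¹-closed = M.⁻¹-closed
    ; normal    = M.normal
    }
    where module M = NormalSubgroup M

module _ (G : Group c ℓ) where
  open Group G
  open GroupProperties G
  open SetoidReasoning setoid

  Centre : Pred Carrier (c ⊔ ℓ)
  Centre x = ∀ y → x ∙ y ≈ y ∙ x

  -- Finite subsets are lists of elements; list membership is taken up to the
  -- equality of G, so over a quotient G / N a list over G stands for its image.
  Centralizer : List Carrier → Pred Carrier (c ⊔ ℓ)
  Centralizer A x = ∀ y → Membership._∈_ setoid y A → x ∙ y ≈ y ∙ x

  centre : NormalSubgroup G (c ⊔ ℓ)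
  centre = record
    { Member    = Centre
    ; resp      = λ x≈y xc z → trans (∙-congʳ (sym x≈y)) (trans (xc z) (∙-congˡ x≈y))
    ; ε-closed  = λ y → trans (identityˡ y) (sym (identityʳ y))
    ; ∙-closed  = λ {x} {y} xc yc z → begin
        x ∙ y ∙ z    ≈⟨ assoc x y z ⟩
        x ∙ (y ∙ z)  ≈⟨ ∙-congˡ (yc z) ⟩
        x ∙ (z ∙ y)  ≈⟨ assoc x z y ⟨
        x ∙ z ∙ y    ≈⟨ ∙-congʳ (xc z) ⟩
        z ∙ x ∙ y    ≈⟨ assoc z x y ⟩
        z ∙ (x ∙ y)  ∎
    ; ⁻¹-closed = λ {x} xc z → begin
        x ⁻¹ ∙ z                 ≈⟨ ∙-congˡ (//-rightDividesʳ x z) ⟨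
        x ⁻¹ ∙ (z ∙ x ∙ x ⁻¹)    ≈⟨ ∙-congˡ (∙-congʳ (xc z)) ⟨
        x ⁻¹ ∙ (x ∙ z ∙ x ⁻¹)    ≈⟨ ∙-congˡ (assoc x z (x ⁻¹)) ⟩
        x ⁻¹ ∙ (x ∙ (z ∙ x ⁻¹))  ≈⟨ \\-leftDividesʳ x (z ∙ x ⁻¹) ⟩
        z ∙ x ⁻¹                 ∎
    ; normal    = λ g {x} xc z →
        let conj : g ⁻¹ ∙ x ∙ g ≈ x
            conj = trans (assoc _ _ _) (trans (∙-congˡ (xc g)) (\\-leftDividesʳ g x))
        in trans (∙-congʳ conj) (trans (xc z) (∙-congˡ (sym conj)))
    }

  trivial : NormalSubgroup G (c ⊔ ℓ)
  trivial = record
    { Member    = λ x → Lift (c ⊔ ℓ) (x ≈ ε)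
    ; resp      = λ x≈y (lift x≈ε) → lift (trans (sym x≈y) x≈ε)
    ; ε-closed  = lift refl
    ; ∙-closed  = λ (lift x≈ε) (lift y≈ε) → lift (trans (∙-cong x≈ε y≈ε) (identityˡ ε))
    ; ⁻¹-closed = λ (lift x≈ε) → lift (trans (⁻¹-cong x≈ε) ε⁻¹≈ε)
    ; normal    = λ g (lift x≈ε) → lift
        (trans (∙-congʳ (trans (∙-congˡ x≈ε) (identityʳ (g ⁻¹)))) (inverseˡ g))
    }

Z : (G : Group c ℓ) → ℕ → NormalSubgroup G (c ⊔ ℓ)
Z G zero    = trivial G
Z G (suc i) = preimage G (Z G i) (centre (G / Z G i))

NilpotentOfClassAtMost : Group c ℓ → ℕ → Set (c ⊔ ℓ)
NilpotentOfClassAtMost G k = Universal (Member (Z G k))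

module _ (G : Group c ℓ) where
  open Group G

  [_,_] : Carrier → Carrier → Carrier
  [ a , b ] = a ⁻¹ ∙ b ⁻¹ ∙ a ∙ b

  -- leftNormed k x is the commutator [x₀, …, x_k] of k + 1 entries, with [x₀] = x₀.
  leftNormed : ∀ k → (Fin (suc k) → Carrier) → Carrier
  leftNormed zero    x = x zero
  leftNormed (suc k) x = [ leftNormed k (x ∘ inject₁) , x (fromℕ (suc k)) ]

  LeftTranslate : Carrier → Pred Carrier p → Pred Carrier (c ⊔ ℓ ⊔ p)
  LeftTranslate a X z = ∃[ x ] x ∈ X × z ≈ a ∙ x

  -- The m translates need not be distinct.
  Large : ℕ → Pred Carrier p → Set (c ⊔ ℓ ⊔ p)
  Large m X = (a : Fin m → Carrier) → ∃[ z ] (∀ j → z ∈ LeftTranslate (a j) X)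

_^ᴳ_ : Group c ℓ → ℕ → Group c ℓ
G ^ᴳ n = Pointwise.group (Fin n) G

{-# OPTIONS --safe #-}
-- Largeness yields a single z such that [b₀z₀, …, b_k z_k] = c whenever b₀ is 1
-- or a fixed element b, and each later b_j is 1 or an element of A_{k-j}.  Let w
-- be the commutator of the first k entries.  Then [w, z_k] = [w, a z_k] for all
-- a ∈ A₀, so w commutes with A₀ and is therefore central; in particular c = 1.
-- Dropping the last entry and passing to G / Z₁, then G / Z₂, and so on, one
-- finally gets that z₀ and b z₀ lie in Z_k, hence so does b.
module Submission where

open import Defs
open import Algebra.Bundles using (Group)
import Algebra.Properties.Group as GroupProperties
open import Data.Fin.Base
  using (Fin; zero; suc; toℕ; fromℕ; fromℕ<; inject₁; opposite; combine; remQuot; funToFin; finToFun)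
open import Data.Fin.Properties
  using (toℕ<n; toℕ-fromℕ; toℕ-fromℕ<; toℕ-inject₁; opposite-prop; finToFun-funToFin; remQuot-combine)
open import Data.List.Base using (List; []; _∷_; length)
import Data.List.Membership.Propositional as Membership
open import Data.List.Relation.Unary.Any using (here; there)
open import Data.Nat.Base using (ℕ; zero; suc; _+_; _*_; _^_; _∸_; _≤_; _<_; z≤n; s≤s)
open import Data.Nat.Properties using (+-suc; +-comm; +-identityʳ; m+n∸m≡n; <⇒≤; ≤-refl; ≤-trans; ≤-reflexive)
open import Data.Product.Base using (∃-syntax; _×_; _,_; proj₁; proj₂)
open import Data.Vec.Functional using (Vector; tail; insertAt) renaming (_∷_ to _∷ᵛ_)
open import Function.Base using (_∘_)
open import Level using (Level; lower)
open import Relation.Binary.PropositionalEquality as ≡ using (_≡_)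
import Relation.Binary.Reasoning.Setoid as SetoidReasoning
open import Relation.Unary using (Pred; _∈_; _⊆_; _≐_)

private
  variable
    a g ℓ p : Level
    A : Set a

-- Vectors extended at the end, where `leftNormed` splits off entries, and padded lists.

_∷ʳ_ : ∀ {n} → Vector A n → A → Vector A (suc n)
xs ∷ʳ x = insertAt xs (fromℕ _) x

∷ʳ-fromℕ : ∀ {n} (xs : Vector A n) x → (xs ∷ʳ x) (fromℕ n) ≡ x
∷ʳ-fromℕ {n = zero}  xs x = ≡.refl
∷ʳ-fromℕ {n = suc n} xs x = ∷ʳ-fromℕ (tail xs) x

∷ʳ-inject₁ : ∀ {n} (xs : Vector A n) x i → (xs ∷ʳ x) (inject₁ i) ≡ xs i
∷ʳ-inject₁ xs x zero    = ≡.refl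
∷ʳ-inject₁ xs x (suc i) = ∷ʳ-inject₁ (tail xs) x i

∷ʳ-∈ : ∀ {n} {xs : Vector A n} {x} (P : Vector (Pred A p) (suc n)) →
       (∀ i → xs i ∈ P (inject₁ i)) → x ∈ P (fromℕ n) → ∀ i → (xs ∷ʳ x) i ∈ P i
∷ʳ-∈ {n = zero}  P xs∈ x∈ zero    = x∈
∷ʳ-∈ {n = suc n} P xs∈ x∈ zero    = xs∈ zero
∷ʳ-∈ {n = suc n} P xs∈ x∈ (suc i) = ∷ʳ-∈ (tail P) (xs∈ ∘ suc) x∈ i

-- Padding lets lists of different lengths, all at most `s`, share the index type `Fin (s + 1)`; the
-- index `s` then always yields the default.
lookupDefault : A → List A → ℕ → A
lookupDefault d []       n       = d
lookupDefault d (x ∷ xs) zero    = x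
lookupDefault d (x ∷ xs) (suc n) = lookupDefault d xs n

lookupDefault-≥ : ∀ (d : A) xs {n} → length xs ≤ n → lookupDefault d xs n ≡ d
lookupDefault-≥ d []       len       = ≡.refl
lookupDefault-≥ d (x ∷ xs) (s≤s len) = lookupDefault-≥ d xs len

module _ {A : Set a} where
  open Membership using () renaming (_∈_ to _∈ᴸ_)

  lookupDefault-∈ : ∀ (d : A) {x xs} → x ∈ᴸ xs → ∃[ n ] n < length xs × lookupDefault d xs n ≡ x
  lookupDefault-∈ d (here ≡.refl) = 0 , s≤s z≤n , ≡.refl
  lookupDefault-∈ d (there x∈xs) with lookupDefault-∈ d x∈xs
  ... | n , n< , eq = suc n , s≤s n< , eq

-- Commutator identities.

module _ (G : Group g ℓ) where
  open Group G
  open GroupProperties G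
  open SetoidReasoning setoid

  [,]-cong : ∀ {x y u v} → x ≈ y → u ≈ v → [_,_] G x u ≈ [_,_] G y v
  [,]-cong x≈y u≈v = ∙-cong (∙-cong (∙-cong (⁻¹-cong x≈y) (⁻¹-cong u≈v)) x≈y) u≈v

  leftNormed-cong : ∀ k {u v : Vector Carrier (suc k)} → (∀ i → u i ≈ v i) →
                    leftNormed G k u ≈ leftNormed G k v
  leftNormed-cong zero    u≈v = u≈v zero
  leftNormed-cong (suc k) u≈v =
    [,]-cong (leftNormed-cong k (u≈v ∘ inject₁)) (u≈v (fromℕ (suc k)))

  yx[x,y]≈xy : ∀ x y → (y ∙ x) ∙ [_,_] G x y ≈ x ∙ y
  yx[x,y]≈xy x y = begin
    (y ∙ x) ∙ (x ⁻¹ ∙ y ⁻¹ ∙ x ∙ y)    ≈⟨ ∙-congˡ (∙-congʳ (∙-congʳ (⁻¹-anti-homo-∙ y x))) ⟨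
    (y ∙ x) ∙ ((y ∙ x) ⁻¹ ∙ x ∙ y)     ≈⟨ ∙-congˡ (assoc _ x y) ⟩
    (y ∙ x) ∙ ((y ∙ x) ⁻¹ ∙ (x ∙ y))   ≈⟨ \\-leftDividesˡ (y ∙ x) (x ∙ y) ⟩
    x ∙ y                              ∎

  commute⇒[,]≈ε : ∀ x y → x ∙ y ≈ y ∙ x → [_,_] G x y ≈ ε
  commute⇒[,]≈ε x y xy≈yx = identityʳ-unique (y ∙ x) _ (trans (yx[x,y]≈xy x y) xy≈yx)

  -- `[w, x]` is the factor by which `w x` differs from `x w`. If moving `w` past `a y` costs the
  -- same factor as moving it past `y`, then moving it past `a` costs nothing.
  [,]-≈⇒commute : ∀ w a y → [_,_] G w (a ∙ y) ≈ [_,_] G w y → w ∙ a ≈ a ∙ w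
  [,]-≈⇒commute w a y eq = ∙-cancelʳ y (w ∙ a) (a ∙ w) (begin
    w ∙ a ∙ y                          ≈⟨ assoc w a y ⟩
    w ∙ (a ∙ y)                        ≈⟨ yx[x,y]≈xy w (a ∙ y) ⟨
    (a ∙ y ∙ w) ∙ [_,_] G w (a ∙ y)    ≈⟨ ∙-cong (assoc a y w) eq ⟩
    (a ∙ (y ∙ w)) ∙ [_,_] G w y        ≈⟨ assoc a (y ∙ w) _ ⟩
    a ∙ ((y ∙ w) ∙ [_,_] G w y)        ≈⟨ ∙-congˡ (yx[x,y]≈xy w y) ⟩
    a ∙ (w ∙ y)                        ≈⟨ assoc a w y ⟨
    a ∙ w ∙ y                          ∎)

-- Equality in a quotient.

module _ (G : Group g ℓ) (N : NormalSubgroup G p) where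
  open Group G
  open GroupProperties G
  open NormalSubgroup N hiding (Member)
  private module Q = Group (G / N)

  ≈⇒≈/ : ∀ {x y} → x ≈ y → x Q.≈ y
  ≈⇒≈/ x≈y = resp (trans (sym (inverseˡ _)) (∙-congˡ x≈y)) ε-closed

  ∈⇒≈/ε : ∀ {x} → x ∈ Member N → x Q.≈ ε
  ∈⇒≈/ε x∈N = resp (sym (identityʳ _)) (⁻¹-closed x∈N)

  ≈/ε⇒∈ : ∀ {x} → x Q.≈ ε → x ∈ Member N
  ≈/ε⇒∈ {x} x≈ε = resp (trans (⁻¹-cong (identityʳ _)) (⁻¹-involutive x)) (⁻¹-closed x≈ε)

-- Constant commutators on boxes and the upper central series.

module _ (G : Group g ℓ) where
  open Group G
  open Membership using () renaming (_∈_ to _∈ᴸ_)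

  Box : ∀ {n} → Vector (Pred Carrier p) n → Pred (Vector Carrier n) p
  Box P v = ∀ i → v i ∈ P i

  -- S holds enough values to test centrality modulo Z i: an element w with
  -- [w, x] constant for x ∈ S commutes with A, hence is central.
  Detects : ℕ → Pred Carrier p → Set _
  Detects i S = ∃[ A ] Centralizer (G / Z G i) A ⊆ Centre (G / Z G i)
                × ∃[ y ] y ∈ S × (∀ {a} → a ∈ᴸ A → a ∙ y ∈ S)

  module _ (i k : ℕ) {P : Vector (Pred Carrier p) (suc (suc k))} {c : Carrier}
           (detects : Detects i (P (fromℕ (suc k))))
           (constant : ∀ v → v ∈ Box P → Group._≈_ (G / Z G i) (leftNormed G (suc k) v) c)
           (v : Vector Carrier (suc k)) (v∈ : v ∈ Box (P ∘ inject₁)) where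

    private
      module Q = Group (G / Z G i)

      w : Carrier
      w = leftNormed G k v

      [w,x]≈c : ∀ {x} → x ∈ P (fromℕ (suc k)) → [_,_] G w x Q.≈ c
      [w,x]≈c {x} x∈ = Q.trans (≈⇒≈/ G (Z G i) snoc≈) (constant (v ∷ʳ x) (∷ʳ-∈ P v∈ x∈))
        where
        snoc≈ : [_,_] G w x ≈ leftNormed G (suc k) (v ∷ʳ x)
        snoc≈ = [,]-cong G
          (leftNormed-cong G k (λ j → reflexive (≡.sym (∷ʳ-inject₁ v x j))))
          (reflexive (≡.sym (∷ʳ-fromℕ v x)))

    leftNormed-init-central : leftNormed G k v ∈ Member (Z G (suc i))
    leftNormed-init-central = let A , C[A]⊆Z , y , y∈ , ay∈ = detects in C[A]⊆Z λ x x∈A →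
      -- Membership in `Centralizer` is up to equality modulo `Z G i`, so `x` is first replaced by a
      -- listed element `a` congruent to it.
      let a , a∈A , x≈a = Membership.find x∈A
          wa≈aw = [,]-≈⇒commute (G / Z G i) w a y
                    (Q.trans ([w,x]≈c (ay∈ a∈A)) (Q.sym ([w,x]≈c y∈)))
      in Q.trans (Q.∙-congˡ {w} x≈a) (Q.trans wa≈aw (Q.∙-congʳ {w} (Q.sym x≈a)))

    -- The constant value is a commutator `[w, y]`, and `w` is central modulo `Z G i`.
    constant≈ε : c Q.≈ ε
    constant≈ε = let _ , _ , y , y∈ , _ = detects in
      Q.trans (Q.sym ([w,x]≈c y∈))
              (commute⇒[,]≈ε (G / Z G i) w y (leftNormed-init-central y))

  descent : ∀ k i {P : Vector (Pred Carrier p) (suc k)} →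
            (∀ j n → toℕ (suc j) + n ≡ k + i → Detects n (P (suc j))) →
            (∀ v → v ∈ Box P → leftNormed G k v ∈ Member (Z G i)) →
            ∀ {x} → x ∈ P zero → x ∈ Member (Z G (k + i))
  descent zero    i detects ∈Zᵢ {x} x∈ = ∈Zᵢ (λ _ → x) λ { zero → x∈ }
  descent (suc k) i {P = P} detects ∈Zᵢ {x} x∈ =
    ≡.subst (λ n → x ∈ Member (Z G n)) (+-suc k i)
      (descent k (suc i) {P = P ∘ inject₁} detects′
        (leftNormed-init-central i k {P = P} (detects (fromℕ k) i (≡.cong (λ n → suc n + i) (toℕ-fromℕ k)))
          (λ v v∈ → ∈⇒≈/ε G (Z G i) (∈Zᵢ v v∈)))
        x∈)
    where
    detects′ : ∀ j n → toℕ (suc j) + n ≡ k + suc i → Detects n (P (suc (inject₁ j)))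
    detects′ j n eq = detects (inject₁ j) n
      (≡.trans (≡.cong (λ m → suc m + n) (toℕ-inject₁ j)) (≡.trans eq (+-suc k i)))

  -- The translates are indexed by codes of pairs `(t , f)` and taken by inverses of shifts, because
  -- `z ∈ s⁻¹X` means `s z ∈ X`. Allowing any `v` pointwise equal to the shifted `z` avoids
  -- comparing functions for strict equality.
  Large⇒grid : ∀ {k m n} {X : Pred (Vector Carrier (suc k)) p} →
               (∀ {u v} → (∀ i → u i ≈ v i) → u ∈ X → v ∈ X) →
               Large (G ^ᴳ suc k) (n * m ^ k) X →
               (b : Fin n → Carrier) (d : Fin k → Fin m → Carrier) →
               ∃[ z ] (∀ t (f : Fin k → Fin m) v →
                 (∀ i → v i ≈ (b t ∷ᵛ λ l → d l (f l)) i ∙ z i) → v ∈ X)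
  Large⇒grid {k = k} {m} {n} X-resp large b d = proj₁ (large shift⁻¹) , λ t f v v≈ →
    let j = combine t (funToFin f)
        x , x∈X , z≈s⁻¹x = proj₂ (large shift⁻¹) j
        rq = remQuot-combine {n} {m ^ k} t (funToFin f)
        shift≡ : ∀ i → shift j i ≡ (b t ∷ᵛ λ l → d l (f l)) i
        shift≡ = λ where
          zero    → ≡.cong (b ∘ proj₁) rq
          (suc l) → ≡.cong (d l) (≡.trans (≡.cong (λ r → finToFun (proj₂ r) l) rq)
                                          (finToFun-funToFin f l))
    in X-resp (λ i → begin
         x i                                                 ≈⟨ \\-leftDividesˡ (shift j i) (x i) ⟨
         shift j i ∙ (shift j i ⁻¹ ∙ x i)                    ≈⟨ ∙-cong (reflexive (shift≡ i)) (sym (z≈s⁻¹x i)) ⟩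
         (b t ∷ᵛ λ l → d l (f l)) i ∙ proj₁ (large shift⁻¹) i  ≈⟨ v≈ i ⟨
         v i                                                 ∎) x∈X
    where
    open GroupProperties G
    open SetoidReasoning setoid

    shift shift⁻¹ : Fin (n * m ^ k) → Vector Carrier (suc k)
    shift j = let t , r = remQuot {n} (m ^ k) j in b t ∷ᵛ λ l → d l (finToFun r l)
    shift⁻¹ j i = shift j i ⁻¹

-- Choosing the shifts and running the descent.

theorem5p13 : ∀ {g ℓ} (G : Group g ℓ) (let open Group G) (k s : ℕ) → 1 ≤ k →
    (∀ i → i < k → ∃[ A ] length A ≤ s × Centre (G / Z G i) ≐ Centralizer (G / Z G i) A) →
    (c : Carrier) →
    Large (G ^ᴳ suc k) (2 * (s + 1) ^ k) (λ x → leftNormed G k x ≈ c) →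
    c ≈ ε × NilpotentOfClassAtMost G k
theorem5p13 {ℓ = ℓ} G k@(suc k′) s _ detecting c large = c≈ε , nilpotent
  where
  open Group G
  open GroupProperties G

  -- Entry `suc l` becomes the last one once `k - 1 - l` entries are dropped, and that number is
  -- `toℕ (opposite l)`.
  testSet : Fin k → List Carrier
  testSet l = proj₁ (detecting (toℕ (opposite l)) (toℕ<n (opposite l)))

  length-testSet≤s : ∀ l → length (testSet l) ≤ s
  length-testSet≤s l = proj₁ (proj₂ (detecting (toℕ (opposite l)) (toℕ<n (opposite l))))

  entry : Fin k → ℕ → Carrier
  entry l = lookupDefault ε (testSet l)

  module _ (b : Carrier) where
    -- Two shifts for the first entry and `s + 1` for each of the other `k` account for the bound
    -- `2 * (s + 1) ^ k`.
    grid = Large⇒grid G (λ u≈v [u]≈c → trans (leftNormed-cong G k (sym ∘ u≈v)) [u]≈c) large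
                        (ε ∷ᵛ λ _ → b) (λ l t → entry l (toℕ t))
    z = proj₁ grid

    -- Membership carries the index of the shift, from which `constant` reads off the choice
    -- function.
    P : Vector (Pred Carrier ℓ) (suc k)
    P zero    x = ∃[ t ] x ≈ (ε ∷ᵛ λ (_ : Fin 1) → b) t ∙ z zero
    P (suc l) x = ∃[ t ] x ≈ entry l (toℕ {s + 1} t) ∙ z (suc l)

    constant : ∀ v → v ∈ Box G P → leftNormed G k v ≈ c
    constant v v∈ = proj₂ grid (proj₁ (v∈ zero)) (λ l → proj₁ (v∈ (suc l))) v
      λ { zero → proj₂ (v∈ zero) ; (suc l) → proj₂ (v∈ (suc l)) }

    entry∙z∈ : ∀ l {n} → n ≤ s → entry l n ∙ z (suc l) ∈ P (suc l)
    entry∙z∈ l {n} n≤s = fromℕ< n<s+1 ,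
      reflexive (≡.cong (λ m → entry l m ∙ z (suc l)) (≡.sym (toℕ-fromℕ< n<s+1)))
      where
      n<s+1 : n < s + 1
      n<s+1 = ≤-trans (s≤s n≤s) (≤-reflexive (+-comm 1 s))

    z∈ : z ∈ Box G P
    z∈ zero    = zero , sym (identityˡ _)
    -- The index `s` lies beyond the list, so its shift is `ε`.
    z∈ (suc l) with entry∙z∈ l ≤-refl
    ... | t , eq = t , trans (trans (sym (identityˡ _))
            (∙-congʳ (reflexive (≡.sym (lookupDefault-≥ ε (testSet l) (length-testSet≤s l)))))) eq

    detects : ∀ j n → toℕ (suc j) + n ≡ k → Detects G n (P (suc j))
    detects j n eq = ≡.subst (λ n → Detects G n (P (suc j))) level
      ( testSet j , proj₂ (proj₂ (proj₂ (detecting (toℕ (opposite j)) (toℕ<n (opposite j)))))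
      , z (suc j) , z∈ (suc j) , λ a∈A →
          let n , n< , eq = lookupDefault-∈ ε a∈A in
          ≡.subst (λ a → a ∙ z (suc j) ∈ P (suc j)) eq
            (entry∙z∈ j (≤-trans (<⇒≤ n<) (length-testSet≤s j))))
      where
      level : toℕ (opposite j) ≡ n
      level = ≡.trans (opposite-prop j)
        (≡.trans (≡.cong (_∸ toℕ (suc j)) (≡.sym eq)) (m+n∸m≡n (toℕ (suc j)) n))

    detects₀ : Detects G 0 (P (fromℕ k))
    detects₀ = detects (fromℕ k′) 0 (≡.trans (+-identityʳ _) (≡.cong suc (toℕ-fromℕ k′)))

    constant/ : ∀ v → v ∈ Box G P → Group._≈_ (G / Z G 0) (leftNormed G k v) c
    constant/ v v∈ = ≈⇒≈/ G (Z G 0) (constant v v∈)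

    P₀⊆Z : P zero ⊆ Member (Z G k)
    P₀⊆Z {x} x∈ = ≡.subst (λ n → x ∈ Member (Z G n)) (+-comm k′ 1)
      -- The last entry is removed beforehand, with constant value `c` instead of `ε`; hence the
      -- start at level 1.
      (descent G k′ 1 {P = P ∘ inject₁}
        (λ j n eq → detects (inject₁ j) n
          (≡.trans (≡.cong (λ m → suc m + n) (toℕ-inject₁ j)) (≡.trans eq (+-comm k′ 1))))
        (leftNormed-init-central G 0 k′ {P = P} detects₀ constant/)
        x∈)

    b∈Z : b ∈ Member (Z G k)
    b∈Z = resp (//-rightDividesʳ (z zero) b)
      (∙-closed (P₀⊆Z (suc zero , refl)) (⁻¹-closed (P₀⊆Z (z∈ zero))))
      where open NormalSubgroup (Z G k) hiding (Member)

    value≈ε : c ≈ ε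
    -- Equality modulo the trivial subgroup `Z G 0` is equality in `G`.
    value≈ε = lower (≈/ε⇒∈ G (trivial G) {c}
      (constant≈ε G 0 k′ {P = P} detects₀ constant/ (z ∘ inject₁) (z∈ ∘ inject₁)))

  c≈ε : c ≈ ε
  c≈ε = value≈ε ε

  nilpotent : NilpotentOfClassAtMost G k
  -- `z` varies with `b`, but `Z G k` does not, so every element is reached.
  nilpotent = b∈Z
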